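{- For any fixed prime $p$, each of the following three conditions on pairs $(a,b)$ of relatively prime integers $a,b>1$, both coprime to $p$, is satisfied for infinitely many $a$ and $b$: (1) $a\,o_p(a)$ and $b\,o_p(b)$ are relatively prime; (2) $a\,o_p(a)$ is odd, and $b$ is supersingular for $p$; (3) $a$ is supersingular for $p$, and $b\,o_p(b)$ is odd. Moreover, each condition is satisfied for infinitely many primes $a$ and $b$.
   Context: For $n\ge 1$ coprime to $p$, $o_p(n)$ is the multiplicative order of $p$ modulo $n$. A positive integer $n$ coprime to $p$ is called supersingular for $p$ if there is an integer $\nu\geq 1$ with $p^\nu\equiv -1 \pmod n$. "Infinitely many $a$ and $b$" means infinitely many pairs $(a,b)$, and "infinitely many primes $a$ and $b$" means infinitely many pairs $(a,b)$ with $a$ and $b$ both prime. -}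

module Defs where

open import Data.Fin.Base using (Fin; toℕ)
import Data.Fin.Properties as Fin
open import Data.Integer.Base as ℤ using (ℤ; +_; 1ℤ; -1ℤ)
import Data.Integer.Divisibility as ℤ
import Data.Integer.Properties as ℤ
open import Data.List.Base using (List)
open import Data.List.Membership.Propositional using (_∉_)
open import Data.Nat.Base hiding (_⊔_)
open import Data.Nat.Coprimality using (Coprime; coprime-divisor)
open import Data.Nat.Divisibility
open import Data.Nat.DivMod
open import Data.Nat.Primality using (Prime)
open import Data.Nat.Properties
open import Data.Parity.Base using (1ℙ)
open import Data.Product.Base using (∃-syntax; _×_; _,_)
open import Level using (0ℓ; _⊔_)
open import Relation.Binary.PropositionalEquality.Core
  using (_≡_; refl; sym; trans; cong; cong₂; subst)
open import Relation.Nullary using (yes; no)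
open import Relation.Unary using (Pred; Decidable)

infix 4 _≡_[mod_]

_≡_[mod_] : ℤ → ℤ → ℕ → Set
i ≡ j [mod n ] = + n ℤ.∣ i ℤ.- j

Odd : Pred ℕ 0ℓ
Odd n = parity n ≡ 1ℙ

-- Equivalent to there being an injection of ℕ into the elements satisfying P
-- whenever equality on A is decidable, as it is for ℕ × ℕ.
Infinite : ∀ {a ℓ} {A : Set a} → Pred A ℓ → Set (a ⊔ ℓ)
Infinite {A = A} P = ∀ (xs : List A) → ∃[ x ] x ∉ xs × P x

record IsOrder (p n k : ℕ) : Set where
  field
    positive : k ≥ 1
    power    : + (p ^ k) ≡ 1ℤ [mod n ]
    minimal  : ∀ {j} → j ≥ 1 → + (p ^ j) ≡ 1ℤ [mod n ] → k ≤ j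

-- The least k ≥ start satisfying P, provided that there is one with
-- k ≤ start + fuel; otherwise start + fuel.
least : ∀ {ℓ} {P : Pred ℕ ℓ} → Decidable P → (fuel start : ℕ) → ℕ
least P? zero       start = start
least P? (suc fuel) start with P? start
... | yes _ = start
... | no  _ = least P? fuel (suc start)

power≡1? : ∀ p n → Decidable (λ k → + (p ^ k) ≡ 1ℤ [mod n ])
power≡1? p n k = n ∣? ℤ.∣ + (p ^ k) ℤ.- 1ℤ ∣

-- The order of p modulo n never exceeds n, so the search range 1, …, 1 + n suffices.
-- When n = 0 or p is not coprime to n the value is meaningless; in all other
-- cases it is the order, by o-isOrder.
o : (p n : ℕ) → ℕ
o p n = least (power≡1? p n) n 1

record Supersingular (p n : ℕ) : Set where
  field
    positive : n ≥ 1
    coprime  : Coprime n p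
    power    : ∃[ ν ] ν ≥ 1 × + (p ^ ν) ≡ -1ℤ [mod n ]

record Admissible (p a b : ℕ) : Set where
  field
    a>1         : a > 1
    b>1         : b > 1
    coprime-a-b : Coprime a b
    coprime-a-p : Coprime a p
    coprime-b-p : Coprime b p

Condition₁ Condition₂ Condition₃ : (p a b : ℕ) → Set
Condition₁ p a b = Coprime (a * o p a) (b * o p b)
Condition₂ p a b = Odd (a * o p a) × Supersingular p b
Condition₃ p a b = Supersingular p a × Odd (b * o p b)

InfinitelyManyPairs : (p : ℕ) → (ℕ → ℕ → ℕ → Set) → Set
InfinitelyManyPairs p C =
  Infinite {A = ℕ × ℕ} λ (a , b) → Admissible p a b × C p a b

InfinitelyManyPrimePairs : (p : ℕ) → (ℕ → ℕ → ℕ → Set) → Set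
InfinitelyManyPrimePairs p C =
  Infinite {A = ℕ × ℕ} λ (a , b) → Prime a × Prime b × Admissible p a b × C p a b

private
  module _ {ℓ} {P : Pred ℕ ℓ} (P? : Decidable P) where

    least-≥ : ∀ fuel start → start ≤ least P? fuel start
    least-≥ zero       start = ≤-refl
    least-≥ (suc fuel) start with P? start
    ... | yes _ = ≤-refl
    ... | no  _ = ≤-trans (n≤1+n start) (least-≥ fuel (suc start))

    least-minimal : ∀ fuel start {j} → start ≤ j → P j → least P? fuel start ≤ j
    least-minimal zero       start s≤j Pj = s≤j
    least-minimal (suc fuel) start s≤j Pj with P? start
    ... | yes _  = s≤j
    ... | no ¬Ps = least-minimal fuel (suc start)
                     (≤∧≢⇒< s≤j λ { refl → ¬Ps Pj }) Pj

    least-satisfies : ∀ fuel start {j} → start ≤ j → j ≤ start + fuel → P j →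
                      P (least P? fuel start)
    least-satisfies zero start {j} s≤j j≤s Pj =
      subst P (≤-antisym (subst (j ≤_) (+-identityʳ start) j≤s) s≤j) Pj
    least-satisfies (suc fuel) start {j} s≤j j≤s+f Pj with P? start
    ... | yes Ps = Ps
    ... | no ¬Ps = least-satisfies fuel (suc start)
                     (≤∧≢⇒< s≤j λ { refl → ¬Ps Pj })
                     (subst (j ≤_) (+-suc start fuel) j≤s+f) Pj

  coprime-power-divisor : ∀ {p n m} i → Coprime n p → n ∣ p ^ i * m → n ∣ m
  coprime-power-divisor {n = n} {m} zero c d = subst (n ∣_) (+-identityʳ m) d
  coprime-power-divisor {p} {n} {m} (suc i) c d =
    coprime-power-divisor i c
      (coprime-divisor c (subst (n ∣_) (*-assoc p (p ^ i) m) d))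

  %≡%⇒∣∸ : ∀ x y n .{{_ : NonZero n}} → x % n ≡ y % n → n ∣ y ∸ x
  %≡%⇒∣∸ x y n eq = divides (y / n ∸ x / n)
    (trans (cong₂ _∸_ (trans (m≡m%n+[m/n]*n y n) (cong (_+ y / n * n) (sym eq)))
                      (m≡m%n+[m/n]*n x n))
    (trans ([m+n]∸[m+o]≡n∸o (x % n) (y / n * n) (x / n * n))
           (sym (*-distribʳ-∸ n (y / n) (x / n)))))

  ∣∸1⇒≡1 : ∀ {n} x → x ≥ 1 → n ∣ x ∸ 1 → + x ≡ 1ℤ [mod n ]
  ∣∸1⇒≡1 {n} x x≥1 = subst (n ∣_)
    (sym (cong ℤ.∣_∣ (trans (ℤ.m-n≡m⊖n x 1) (ℤ.⊖-≥ x≥1))))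

  -- If p is not positive then n = 1, and the congruence is trivial.
  ∣^∸1⇒≡1 : ∀ {p n} k → Coprime n p → n ∣ p ^ k ∸ 1 → + (p ^ k) ≡ 1ℤ [mod n ]
  ∣^∸1⇒≡1 {zero}  {n} k c d rewrite c (∣-refl , (n ∣0)) = 1∣ _
  ∣^∸1⇒≡1 {suc p} k c d = ∣∸1⇒≡1 (suc p ^ k) (m^n>0 (suc p) k) d

  bounded-power : ∀ p n → .{{_ : NonZero n}} → Coprime n p →
                  ∃[ k ] 1 ≤ k × k ≤ n × + (p ^ k) ≡ 1ℤ [mod n ]
  bounded-power p n c
    with i , j , i<j , eq ← Fin.pigeonhole (n<1+n n)
                              (λ (i : Fin (suc n)) → (p ^ toℕ i) mod n)
    = k , m<n⇒0<n∸m i<j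
    , ≤-trans (m∸n≤m (toℕ j) (toℕ i)) (≤-pred (Fin.toℕ<n j))
    , ∣^∸1⇒≡1 k c (coprime-power-divisor (toℕ i) c
        (subst (n ∣_) factor
          (%≡%⇒∣∸ (p ^ toℕ i) (p ^ toℕ j) n
            (Fin.fromℕ<-injective _ _ _ _ eq))))
    where
    k = toℕ j ∸ toℕ i
    factor : p ^ toℕ j ∸ p ^ toℕ i ≡ p ^ toℕ i * (p ^ k ∸ 1)
    factor = sym (trans (*-distribˡ-∸ (p ^ toℕ i) (p ^ k) 1)
      (cong₂ _∸_
        (trans (sym (^-distribˡ-+-* p (toℕ i) k))
               (cong (p ^_) (m+[n∸m]≡n (<⇒≤ i<j))))
        (*-identityʳ (p ^ toℕ i))))

o-isOrder : ∀ p n .{{_ : NonZero n}} → Coprime n p → IsOrder p n (o p n)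
o-isOrder p n c with k , 1≤k , k≤n , pᵏ≡1 ← bounded-power p n c = record
  { positive = least-≥ P? n 1
  ; power    = least-satisfies P? n 1 1≤k (≤-trans k≤n (n≤1+n n)) pᵏ≡1
  ; minimal  = least-minimal P? n 1
  }
  where P? = power≡1? p n

{-# OPTIONS --safe #-}

-- Fix a prime s ≠ p with p ≡ −1 (mod s), namely s = 2 for odd p and s = 3 for p = 2.
-- For a prime q > p, every prime r dividing (p^q − 1)/(p − 1) has o_p(r) = q:
-- otherwise o_p(r) = 1, so r ∣ p − 1, hence (p^q − 1)/(p − 1) ≡ q (mod r) and
-- r = q > p.  In particular r tends to infinity with q, so r and o_p(r) are both primes
-- beyond any prescribed bound.  As soon as they exceed s o_p(s) and 2, the product
-- r o_p(r) is odd and coprime to s o_p(s).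
module Submission where

open import Data.Integer.Base using (+_; 1ℤ)
open import Data.List.Base using ([]; _∷_; map)
open import Data.List.Extrema.Nat using (max; xs≤max)
open import Data.List.Membership.Propositional.Properties using (∈-map⁺)
open import Data.List.Relation.Unary.All using ([]; _∷_; lookup)
open import Data.Nat.Base hiding (_⊔_)
open import Data.Nat.Coprimality as Coprime using (Coprime; coprime-divisor; prime⇒coprime)
open import Data.Nat.Divisibility
open import Data.Nat.DivMod using (_/_; _%_; m≡m%n+[m/n]*n; m%n<n)
open import Data.Nat.ListAction using (product)
open import Data.Nat.Primality
open import Data.Nat.Primality.Factorisation using (factorise; module PrimeFactorisation)
open import Data.Nat.Properties
open import Data.Nat.Tactic.RingSolver using (solve-∀)
import Data.Parity.Base as ℙ
open import Data.Parity.Properties using (*-homo-*)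
open import Data.Product.Base using (∃-syntax; _×_; _,_; proj₁; proj₂)
open import Data.Sum.Base as Sum using (_⊎_; inj₁; inj₂)
open import Defs
open import Function.Base using (id)
open import Relation.Binary.PropositionalEquality.Core
  using (_≡_; refl; sym; trans; cong; cong₂; subst)
open import Relation.Binary.PropositionalEquality.Properties using (module ≡-Reasoning)
open import Relation.Nullary using (yes; no)
open import Relation.Nullary.Decidable using (from-yes)
open import Relation.Nullary.Negation using (contradiction)
open import Relation.Unary using (Pred; Decidable; _⊆_)

private variable
  k m n p : ℕ

-- Infinite families

Infinite-⊆ : ∀ {a ℓ₁ ℓ₂} {A : Set a} {P : Pred A ℓ₁} {Q : Pred A ℓ₂} →
             P ⊆ Q → Infinite P → Infinite Q
Infinite-⊆ P⊆Q inf xs with x , x∉xs , Px ← inf xs = x , x∉xs , P⊆Q Px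

-- The values of `f` on a finite list have a maximum, and an element with a larger value cannot be
-- in the list.
unbounded⇒infinite : ∀ {a ℓ} {A : Set a} {P : Pred A ℓ} (f : A → ℕ) →
                     (∀ N → ∃[ x ] f x > N × P x) → Infinite P
unbounded⇒infinite f unbounded xs
  with x , fx>max , Px ← unbounded (max 0 (map f xs))
  = x
  , (λ x∈xs → <⇒≱ fx>max (lookup (xs≤max 0 (map f xs)) (∈-map⁺ f x∈xs)))
  , Px

-- Parity and coprimality

2∣n⊎odd : ∀ n → 2 ∣ n ⊎ Odd n
2∣n⊎odd zero          = inj₁ (2 ∣0)
2∣n⊎odd (suc zero)    = inj₂ refl
2∣n⊎odd (suc (suc n)) = Sum.map (∣m∣n⇒∣m+n ∣-refl) id (2∣n⊎odd n)

odd⇒2∣1+n : ∀ n → Odd n → 2 ∣ suc n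
odd⇒2∣1+n (suc zero)    _   = ∣-refl
odd⇒2∣1+n (suc (suc n)) odd = ∣m∣n⇒∣m+n ∣-refl (odd⇒2∣1+n n odd)

odd-* : ∀ m n → Odd m → Odd n → Odd (m * n)
odd-* m n odd-m odd-n = trans (*-homo-* m n) (cong₂ ℙ._*_ odd-m odd-n)

prime>2⇒odd : Prime p → p > 2 → Odd p
prime>2⇒odd {p} p-prime p>2 with 2∣n⊎odd p
... | inj₂ odd = odd
... | inj₁ 2∣p with prime⇒irreducible p-prime 2∣p
...   | inj₂ refl = contradiction p>2 (<-irrefl refl)

-- A common divisor of `m` and `n * k` is coprime to `n`, being a divisor of `m`, so it must divide
-- `k`.
coprime-*ʳ : Coprime m n → Coprime m k → Coprime m (n * k)
coprime-*ʳ m⊥n m⊥k {d} (d∣m , d∣nk) = m⊥k (d∣m , coprime-divisor d⊥n d∣nk)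
  where
  d⊥n : Coprime d _
  d⊥n (e∣d , e∣n) = m⊥n (∣-trans e∣d d∣m , e∣n)

-- Existence of large primes

primeDivisor : ∀ n .{{_ : NonTrivial n}} → ∃[ r ] Prime r × r ∣ n
primeDivisor n = helper (factorise n {{nonTrivial⇒nonZero n}})
  where
  open PrimeFactorisation
  helper : _ → ∃[ r ] Prime r × r ∣ n
  helper record { factors = [] ; isFactorisation = n≡1 } =
    contradiction n≡1 nonTrivial⇒≢1
  helper record { factors = r ∷ rs ; isFactorisation = eq ; factorsPrime = r-prime ∷ _ } =
    r , r-prime , subst (r ∣_) (sym eq) (m∣m*n (product rs))

m≤n⇒m∣n! : .{{NonZero m}} → m ≤ n → m ∣ n !
m≤n⇒m∣n! {suc m} m≤n = ∣-trans (m∣m*n (m !)) (m≤n⇒m!∣n! m≤n)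

-- Euclid's argument: a prime divisor of `1 + N !` that is at most `N` would also divide `N !`,
-- hence 1.
primeAbove : ∀ N → ∃[ q ] q > N × Prime q
primeAbove N
  with q , q-prime , q∣1+N! ← primeDivisor (suc (N !)) {{n>1⇒nonTrivial (s<s (1≤n! N))}}
  = q , ≰⇒> q≰N , q-prime
  where
  instance _ = prime⇒nonZero q-prime
  q≰N = λ q≤N → contradiction
    (subst Prime
      (∣1⇒≡1 (∣m+n∣m⇒∣n (subst (q ∣_) (+-comm 1 (N !)) q∣1+N!) (m≤n⇒m∣n! q≤N))) q-prime)
    ¬prime[1]

-- Congruences to 1 and multiplicative orders

≡1-* : ∀ x y .{{_ : NonZero x}} .{{_ : NonZero y}} →
       + x ≡ 1ℤ [mod n ] → + y ≡ 1ℤ [mod n ] → + (x * y) ≡ 1ℤ [mod n ]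
-- For a successor, `+ suc u ≡ 1ℤ [mod n ]` computes to `n ∣ u`, and the goal to
-- `n ∣ v + u * suc v`.
≡1-* (suc u) (suc v) n∣u n∣v = ∣m∣n⇒∣m+n n∣v (∣m⇒∣m*n (suc v) n∣u)

-- This rests on xy - 1 = x(y - 1) + (x - 1).
≡1-cancelʳ : ∀ x y .{{_ : NonZero x}} .{{_ : NonZero y}} →
             + (x * y) ≡ 1ℤ [mod n ] → + y ≡ 1ℤ [mod n ] → + x ≡ 1ℤ [mod n ]
≡1-cancelʳ {n} (suc u) (suc v) n∣v+uy n∣v =
  ∣m+n∣m⇒∣n (subst (n ∣_) (rearrange u v) n∣v+uy) (∣n⇒∣m*n (suc u) n∣v)
  where
  rearrange : ∀ u v → v + u * suc v ≡ suc u * v + u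
  rearrange = solve-∀

≡1-^ : ∀ x .{{_ : NonZero x}} m → + x ≡ 1ℤ [mod n ] → + (x ^ m) ≡ 1ℤ [mod n ]
≡1-^ x zero    x≡1 = _ ∣0
≡1-^ x (suc m) x≡1 = ≡1-* x (x ^ m) x≡1 (≡1-^ x m x≡1)
  where instance _ = m^n≢0 x m

-- Cancelling a power of `p ^ k` from `p ^ m` gives `p ^ (m % k)` ≡ 1; as `m % k < k`, minimality
-- forces the remainder to be 0.
order-∣ : .{{_ : NonZero p}} → IsOrder p n k → ∀ m → + (p ^ m) ≡ 1ℤ [mod n ] → k ∣ m
order-∣ {p} {n} {k} k-order m pᵐ≡1 = m%n≡0⇒n∣m m k (n≤0⇒n≡0 (≮⇒≥ m%k≯0))
  where
  open IsOrder k-order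
  instance
    k≢0 : NonZero k
    k≢0 = >-nonZero positive
    pᵏ≢0 : NonZero (p ^ k)
    pᵏ≢0 = m^n≢0 p k

  factor : p ^ m ≡ p ^ (m % k) * (p ^ k) ^ (m / k)
  factor = begin
    p ^ m                             ≡⟨ cong (p ^_) (m≡m%n+[m/n]*n m k) ⟩
    p ^ (m % k + m / k * k)           ≡⟨ ^-distribˡ-+-* p (m % k) (m / k * k) ⟩
    p ^ (m % k) * p ^ (m / k * k)     ≡⟨ cong (λ e → p ^ (m % k) * p ^ e) (*-comm (m / k) k) ⟩
    p ^ (m % k) * p ^ (k * (m / k))   ≡⟨ cong (p ^ (m % k) *_) (^-*-assoc p k (m / k)) ⟨
    p ^ (m % k) * (p ^ k) ^ (m / k)   ∎
    where open ≡-Reasoning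

  m%k≯0 = λ m%k>0 → <⇒≱ (m%n<n m k) (minimal m%k>0
    (≡1-cancelʳ (p ^ (m % k)) ((p ^ k) ^ (m / k)) {{m^n≢0 p (m % k)}} {{m^n≢0 (p ^ k) (m / k)}}
      (subst (λ x → + x ≡ 1ℤ [mod n ]) factor pᵐ≡1)
      (≡1-^ (p ^ k) (m / k) power)))

-- This yields `o p n ≤ 1 + n`, so that a large order forces a large modulus.
least-≤ : ∀ {ℓ} {P : Pred ℕ ℓ} (P? : Decidable P) fuel start → least P? fuel start ≤ start + fuel
least-≤ P? zero       start = m≤m+n start 0
least-≤ P? (suc fuel) start with P? start
... | yes _ = m≤m+n start (suc fuel)
... | no  _ = ≤-trans (least-≤ P? fuel (suc start)) (≤-reflexive (sym (+-suc start fuel)))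

-- Prime divisors of the repunits 1 + x + ... + x^(n - 1) = (x^n - 1)/(x - 1)

repunit : ℕ → ℕ → ℕ
repunit x zero    = 0
repunit x (suc n) = suc (x * repunit x n)

-- The geometric sum, with base `suc u` in place of x - 1 to avoid truncated subtraction. It makes
-- x^n ≡ 1 modulo every divisor of the repunit.
[1+u]^n≡1+u*repunit : ∀ u n → suc u ^ n ≡ suc (u * repunit (suc u) n)
[1+u]^n≡1+u*repunit u zero    = cong suc (sym (*-zeroʳ u))
[1+u]^n≡1+u*repunit u (suc n) =
  trans (cong (suc u *_) ([1+u]^n≡1+u*repunit u n)) (rearrange u (repunit (suc u) n))
  where
  rearrange : ∀ u t → suc u * suc (u * t) ≡ suc (u * suc (suc u * t))
  rearrange = solve-∀

-- Each of the `n` summands is a power of `suc u`, hence 1 modulo `u`.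
repunit≡n+u*t : ∀ u n → ∃[ t ] repunit (suc u) n ≡ n + u * t
repunit≡n+u*t u zero = 0 , sym (*-zeroʳ u)
repunit≡n+u*t u (suc n) with t , eq ← repunit≡n+u*t u n =
  t + (n + u * t) , trans (cong (λ R → suc (suc u * R)) eq) (rearrange u n t)
  where
  rearrange : ∀ u n t → suc (suc u * (n + u * t)) ≡ suc n + u * (t + (n + u * t))
  rearrange = solve-∀

-- The repunit is 1 plus a multiple of `x`, so whatever divides both it and `x` divides 1.
∣repunit⇒coprime : ∀ x n → m ∣ repunit x (suc n) → Coprime m x
∣repunit⇒coprime x n m∣R {d} (d∣m , d∣x) = ∣1⇒≡1
  (∣m+n∣m⇒∣n (subst (d ∣_) (+-comm 1 (x * repunit x n)) (∣-trans d∣m m∣R))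
             (∣m⇒∣m*n (repunit x n) d∣x))

repunit-nonTrivial : .{{NonZero p}} → n > 1 → NonTrivial (repunit p n)
repunit-nonTrivial {p} (s<s (z<s {n})) =
  n>1⇒nonTrivial (s<s (>-nonZero⁻¹ _ {{m*n≢0 p (repunit p (suc n))}}))

order-of-repunit-divisor : ∀ {p q r} → Prime p → Prime q → q > p → Prime r →
                           r ∣ repunit p q → o p r ≡ q
order-of-repunit-divisor {p@(suc u)} {q@(suc q′)} {r} p-prime q-prime q>p r-prime r∣R =
  Sum.[ (λ o≡1 → contradiction q>p (≤⇒≯ (o≡1⇒q≤p o≡1))) , id ]′
    (prime⇒irreducible q-prime (order-∣ r-order q pᵠ≡1))
  where
  instance
    r≢0 : NonZero r
    r≢0 = prime⇒nonZero r-prime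
    u≢0 : NonZero u
    u≢0 = >-nonZero (≤-pred (nonTrivial⇒n>1 p {{prime⇒nonTrivial p-prime}}))

  r-order : IsOrder p r (o p r)
  r-order = o-isOrder p r (∣repunit⇒coprime p q′ r∣R)

  pᵠ≡1 : + (p ^ q) ≡ 1ℤ [mod r ]
  pᵠ≡1 = subst (λ x → + x ≡ 1ℤ [mod r ]) (sym ([1+u]^n≡1+u*repunit u q)) (∣n⇒∣m*n u r∣R)

  o≡1⇒r∣u : o p r ≡ 1 → r ∣ u
  -- `p ^ 1` unfolds to `suc u * 1`, so the congruence reads `r ∣ u * 1`.
  o≡1⇒r∣u o≡1 = subst (r ∣_) (*-identityʳ u)
    (subst (λ k → + (p ^ k) ≡ 1ℤ [mod r ]) o≡1 (IsOrder.power r-order))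

  o≡1⇒q≤p : o p r ≡ 1 → q ≤ p
  o≡1⇒q≤p o≡1 with t , R≡q+ut ← repunit≡n+u*t u q
    -- From `r ∣ q + u * t` and `r ∣ u` follows `r ∣ q`. Since `q` is prime, `r ≡ q`, and then
    -- `q ≤ u < p`.
    with prime⇒irreducible q-prime
           (∣m+n∣m⇒∣n (subst (r ∣_) (trans R≡q+ut (+-comm q (u * t))) r∣R) (∣m⇒∣m*n t (o≡1⇒r∣u o≡1)))
  ... | inj₁ r≡1 = contradiction (subst Prime r≡1 r-prime) ¬prime[1]
  ... | inj₂ r≡q = ≤-trans (subst (_≤ u) r≡q (∣⇒≤ (o≡1⇒r∣u o≡1))) (n≤1+n u)

-- Construction of the prime pairs

module _ (p-prime : Prime p) where

  private instance
    p≢0 : NonZero p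
    p≢0 = prime⇒nonZero p-prime

  largePrimeWithLargePrimeOrder : ∀ N → ∃[ r ] r > N × Prime r × o p r > N × Prime (o p r)
  largePrimeWithLargePrimeOrder N
    -- Exceeding `p` makes `q` the order of `p` modulo `r`; exceeding `suc N` rather than `N` makes
    -- up for the 1 in `o p r ≤ 1 + r`.
    with q , q>1+N+p , q-prime ← primeAbove (suc N + p)
    with r , r-prime , r∣R ← primeDivisor (repunit p q)
           {{repunit-nonTrivial (nonTrivial⇒n>1 q {{prime⇒nonTrivial q-prime}})}}
    = r , ≤-pred (≤-trans 1+N<o (least-≤ (power≡1? p r) r 1)) , r-prime
    , <-trans (n<1+n N) 1+N<o , subst Prime (sym o≡q) q-prime
    where
    o≡q : o p r ≡ q
    o≡q = order-of-repunit-divisor p-prime q-prime (≤-<-trans (m≤n+m p (suc N)) q>1+N+p) r-prime r∣R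
    1+N<o : suc N < o p r
    1+N<o = subst (suc N <_) (sym o≡q) (≤-<-trans (m≤m+n (suc N) p) q>1+N+p)

  supersingularPrime : ∃[ s ] Prime s × Supersingular p s
  supersingularPrime with m≤n⇒m<n∨m≡n (nonTrivial⇒n>1 p {{prime⇒nonTrivial p-prime}})
  ... | inj₁ 2<p = 2 , prime[2] , record
    { positive = s≤s z≤n
    ; coprime  = Coprime.sym (prime⇒coprime p-prime 2<p)
    -- With exponent 1 the congruence unfolds to `2 ∣ p * 1 + 1`.
    ; power    = 1 , ≤-refl , subst (2 ∣_) (eq p) (odd⇒2∣1+n p (prime>2⇒odd p-prime 2<p))
    }
    where
    eq : ∀ n → suc n ≡ n * 1 + 1
    eq = solve-∀
  ... | inj₂ refl = 3 , from-yes (prime? 3) , record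
    { positive = s≤s z≤n
    ; coprime  = prime⇒coprime (from-yes (prime? 3)) ≤-refl
    ; power    = 1 , ≤-refl , ∣-refl
    }

  -- One `r` serves all three conditions: coprimality is for the first, oddness for the other two,
  -- where `s` is the supersingular member.
  largePartner : ∀ {s} → Prime s → Coprime s p → ∀ N →
    ∃[ r ] r > N × Prime r × Admissible p s r × Condition₁ p s r × Odd (r * o p r)
  largePartner {s} s-prime s⊥p N
    -- The bound is at least `N`, `p ≥ 2` and `s * o p s ≥ s`. A prime above it is odd and coprime
    -- to `p`, `s` and `s * o p s`; this applies to both `r` and `o p r`.
    with r , r>M , r-prime , o>M , o-prime ← largePrimeWithLargePrimeOrder (N + (p + s * o p s))
    = r , ≤-<-trans (m≤m+n N _) r>M , r-prime
    , record
      { a>1         = nonTrivial⇒n>1 s {{prime⇒nonTrivial s-prime}}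
      ; b>1         = nonTrivial⇒n>1 r {{prime⇒nonTrivial r-prime}}
      ; coprime-a-b = Coprime.sym (prime⇒coprime r-prime
                        (≤-<-trans (≤-trans (m≤m*n s (o p s)) so≤M) r>M))
      ; coprime-a-p = s⊥p
      ; coprime-b-p = prime⇒coprime r-prime (≤-<-trans p≤M r>M)
      }
    , coprime-*ʳ (Coprime.sym (prime⇒coprime r-prime (≤-<-trans so≤M r>M)))
                 (Coprime.sym (prime⇒coprime o-prime (≤-<-trans so≤M o>M)))
    , odd-* r (o p r) (prime>2⇒odd r-prime (≤-<-trans 2≤M r>M))
                      (prime>2⇒odd o-prime (≤-<-trans 2≤M o>M))
    where
    M = N + (p + s * o p s)
    instance
      s≢0 : NonZero s
      s≢0 = prime⇒nonZero s-prime
      o≢0 : NonZero (o p s)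
      o≢0 = >-nonZero (IsOrder.positive (o-isOrder p s s⊥p))
      so≢0 : NonZero (s * o p s)
      so≢0 = m*n≢0 s (o p s)
    p≤M : p ≤ M
    p≤M = ≤-trans (m≤m+n p _) (m≤n+m _ N)
    so≤M : s * o p s ≤ M
    so≤M = ≤-trans (m≤n+m _ p) (m≤n+m _ N)
    2≤M : 2 ≤ M
    2≤M = ≤-trans (nonTrivial⇒n>1 p {{prime⇒nonTrivial p-prime}}) p≤M

Admissible-sym : ∀ {a b} → Admissible p a b → Admissible p b a
Admissible-sym adm = record
  { a>1         = b>1
  ; b>1         = a>1
  ; coprime-a-b = Coprime.sym coprime-a-b
  ; coprime-a-p = coprime-b-p
  ; coprime-b-p = coprime-a-p
  }
  where open Admissible adm

infinitelyManyPairs : ∀ C → InfinitelyManyPrimePairs p C → InfinitelyManyPairs p C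
infinitelyManyPairs _ = Infinite-⊆ λ (_ , _ , adm , c) → adm , c

lemma6p14 : ∀ (p : ℕ) → Prime p →
    (InfinitelyManyPairs p Condition₁ ×
    InfinitelyManyPairs p Condition₂ ×
    InfinitelyManyPairs p Condition₃) ×
    (InfinitelyManyPrimePairs p Condition₁ ×
    InfinitelyManyPrimePairs p Condition₂ ×
    InfinitelyManyPrimePairs p Condition₃)
lemma6p14 p p-prime with s , s-prime , s-super ← supersingularPrime p-prime =
  (infinitelyManyPairs Condition₁ pairs₁ ,
   infinitelyManyPairs Condition₂ pairs₂ ,
   infinitelyManyPairs Condition₃ pairs₃) ,
  (pairs₁ , pairs₂ , pairs₃)
  where
  partner = largePartner p-prime s-prime (Supersingular.coprime s-super)

  pairs₁ : InfinitelyManyPrimePairs p Condition₁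
  -- While `s` stays fixed, `r` is unbounded, so the projection is always to the coordinate that
  -- holds `r`.
  pairs₁ = unbounded⇒infinite proj₂ λ N →
    let r , r>N , r-prime , adm , cond₁ , _ = partner N
    in (s , r) , r>N , s-prime , r-prime , adm , λ {_} → cond₁

  pairs₂ : InfinitelyManyPrimePairs p Condition₂
  pairs₂ = unbounded⇒infinite proj₁ λ N →
    let r , r>N , r-prime , adm , _ , odd = partner N
    in (r , s) , r>N , r-prime , s-prime , Admissible-sym adm , odd , s-super

  pairs₃ : InfinitelyManyPrimePairs p Condition₃
  pairs₃ = unbounded⇒infinite proj₂ λ N →
    let r , r>N , r-prime , adm , _ , odd = partner N
    in (s , r) , r>N , s-prime , r-prime , adm , s-super , odd
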